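{- Let $\varphi\in\mathcal{L}^\infty$ and let $a\in\mathcal{A}$ be an agent. The following formulas are valid in DPAL in the unambiguous depths setting, i.e. they are true in every state of every DPAL model satisfying: for all agents $b$ and all states $s,s'$, $s\sim_b s'$ implies $d(b,s)=d(b,s')$. (KP, knowledge preservation) For every $\psi\in\mathcal{L}_a^\infty$: $\ \neg P_a^{d(\varphi)}\to\big([\varphi]K_a\psi\leftrightarrow(\varphi\to K_a\psi)\big)$. (TA, traditional announcements) For every $\psi\in\mathcal{L}^\infty$: $\ P_a^{d(\varphi)}\to\big([\varphi]K_a\psi\leftrightarrow(\varphi\to K_a[\varphi]\psi)\big)$.
   Context: Fix a set $\mathcal{A}$ of agents and a set $\mathcal{P}$ of propositional atoms; $\mathbb{N}=\{0,1,2,\dots\}$. The language $\mathcal{L}^\infty$ is generated by $\varphi ::= p \mid E_a^d \mid P_a^d \mid \neg\varphi \mid \varphi\wedge\varphi \mid K_a\varphi \mid K_a^\infty\varphi \mid [\varphi]\varphi$ with $p\in\mathcal{P}$, $a\in\mathcal{A}$, $d\in\mathbb{N}$. Other connectives are the usual abbreviations. $\mathcal{L}_a^\infty$ is the fragment of $\mathcal{L}^\infty$ without depth atoms ($E_b^d$, $P_b^d$) or modal operators ($K_b$, $K_b^\infty$) for agents $b$ other than $a$. Modal depth: $d(p)=d(E_a^d)=d(P_a^d)=0$, $d(\neg\varphi)=d(\varphi)$, $d(\varphi\wedge\psi)=\max(d(\varphi),d(\psi))$, $d(K_a\varphi)=d(K_a^\infty\varphi)=1+d(\varphi)$, $d([\varphi]\psi)=d(\varphi)+d(\psi)$.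 A model is a tuple $M=(\mathcal{S},\sim,V,d)$ with $\mathcal{S}$ a set of states, $\sim_a$ an equivalence relation on $\mathcal{S}$ for each agent $a$, $V:\mathcal{S}\to 2^{\mathcal{P}}$, and $d:\mathcal{A}\times\mathcal{S}\to\mathbb{N}$. Semantics: $(M,s)\models p$ iff $p\in V(s)$; $(M,s)\models E_a^d$ iff $d(a,s)=d$; $(M,s)\models P_a^d$ iff $d(a,s)\ge d$; $\neg,\wedge$ as usual; $(M,s)\models K_a^\infty\varphi$ iff $(M,s')\models\varphi$ for all $s'$ with $s\sim_a s'$; $(M,s)\models K_a\varphi$ iff $(M,s)\models P_a^{d(\varphi)}\wedge K_a^\infty\varphi$. DPAL semantics of announcements: $(M,s)\models[\varphi]\psi$ iff ($(M,s)\models\varphi$ implies $(M\mid\varphi,(1,s))\models\psi$), where $M\mid\varphi=(\mathcal{S}',\sim',V',d')$ with $\mathcal{S}'=(\{0\}\times\mathcal{S})\cup\{(1,s): s\in\mathcal{S},(M,s)\models\varphi\}$; $\sim'_a$ is the transitive symmetric closure of the relation $R_a$ on $\mathcal{S}'$ given by $(i,s)R_a(i,s')$ iff $s\sim_a s'$ (for $i=0,1$), and $(1,s)R_a(0,s)$ iff $(M,s)\not\models P_a^{d(\varphi)}$; $V'((i,s))=V(s)$; $d'(a,(0,s))=d(a,s)$; $d'(a,(1,s))=d(a,s)$ if $d(a,s)<d(\varphi)$, and $d'(a,(1,s))=d(a,s)-d(\varphi)$ otherwise. -}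

module Defs where

open import Level using (Level; _⊔_; suc; Lift)
open import Data.Bool.Base using (if_then_else_)
open import Data.Irrelevant as Irrelevant using (Irrelevant)
open import Data.Nat.Base as ℕ using (ℕ; _≥_; _∸_)
open import Data.Nat.Properties using (_<?_)
open import Data.Product.Base using (_×_)
open import Data.Refinement.Base using (Refinement; Refinement-syntax; value; _,_)
open import Data.Sum.Base using (_⊎_; inj₁; inj₂)
open import Relation.Binary.Core using (Rel)
open import Relation.Binary.Structures using (IsEquivalence)
open import Relation.Binary.Construct.Closure.Symmetric as Sym using (SymClosure; fwd)
open import Relation.Binary.Construct.Closure.Transitive as Trans using (TransClosure)
open import Relation.Binary.PropositionalEquality.Core using (_≡_)
open import Relation.Nullary.Decidable.Core using (does)
open import Relation.Nullary.Negation.Core as Neg using ()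
open import Relation.Unary using (Pred)

private
  variable
    α π ℓ : Level

infix  9 ¬_
infixr 8 _∧_
infixr 9 [_]_

data Formula (Agent : Set α) (Atom : Set π) : Set (α ⊔ π) where
  atom : Atom → Formula Agent Atom
  E    : Agent → ℕ → Formula Agent Atom
  P    : Agent → ℕ → Formula Agent Atom
  ¬_   : Formula Agent Atom → Formula Agent Atom
  _∧_  : Formula Agent Atom → Formula Agent Atom → Formula Agent Atom
  K    : Agent → Formula Agent Atom → Formula Agent Atom
  K∞   : Agent → Formula Agent Atom → Formula Agent Atom
  [_]_ : Formula Agent Atom → Formula Agent Atom → Formula Agent Atom

module _ {Agent : Set α} {Atom : Set π} where

  infixr 7 _⇒_
  infix  6 _⇔_

  _⇒_ : Formula Agent Atom → Formula Agent Atom → Formula Agent Atom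
  φ ⇒ ψ = ¬ (φ ∧ ¬ ψ)

  _⇔_ : Formula Agent Atom → Formula Agent Atom → Formula Agent Atom
  φ ⇔ ψ = (φ ⇒ ψ) ∧ (ψ ⇒ φ)

  modalDepth : Formula Agent Atom → ℕ
  modalDepth (atom p)  = 0
  modalDepth (E a n)   = 0
  modalDepth (P a n)   = 0
  modalDepth (¬ φ)     = modalDepth φ
  modalDepth (φ ∧ ψ)   = modalDepth φ ℕ.⊔ modalDepth ψ
  modalDepth (K a φ)   = 1 ℕ.+ modalDepth φ
  modalDepth (K∞ a φ)  = 1 ℕ.+ modalDepth φ
  modalDepth ([ φ ] ψ) = modalDepth φ ℕ.+ modalDepth ψ

  -- The fragment in which a is the only agent mentioned by depth atoms and
  -- modal operators.
  data Only (a : Agent) : Formula Agent Atom → Set (α ⊔ π) where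
    atom : ∀ p → Only a (atom p)
    E    : ∀ n → Only a (E a n)
    P    : ∀ n → Only a (P a n)
    ¬_   : ∀ {φ} → Only a φ → Only a (¬ φ)
    _∧_  : ∀ {φ ψ} → Only a φ → Only a ψ → Only a (φ ∧ ψ)
    K    : ∀ {φ} → Only a φ → Only a (K a φ)
    K∞   : ∀ {φ} → Only a φ → Only a (K∞ a φ)
    [_]_ : ∀ {φ ψ} → Only a φ → Only a ψ → Only a ([ φ ] ψ)

record Model (Agent : Set α) (Atom : Set π) (ℓ : Level) : Set (α ⊔ π ⊔ suc ℓ) where
  field
    State         : Set ℓ
    _∼[_]_        : State → Agent → State → Set ℓ
    isEquivalence : ∀ a → IsEquivalence (λ s t → s ∼[ a ] t)
    V             : State → Pred Atom ℓ
    depth         : Agent → State → ℕ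

module _ {Agent : Set α} {Atom : Set π} where

  -- The update of M by an announcement with extension X and modal depth n.
  -- inj₁ s is the pair (0 , s); inj₂ (s , _) is the pair (1 , s).  The proof
  -- that s ∈ X is irrelevant, so that there is only one state (1 , s).
  module Update (M : Model Agent Atom ℓ) (X : Pred (Model.State M) ℓ) (n : ℕ) where
    open Model M

    State′ : Set ℓ
    State′ = State ⊎ [ s ∈ State ∣ X s ]

    data R (a : Agent) : Rel State′ ℓ where
      old   : ∀ {s t} → s ∼[ a ] t → R a (inj₁ s) (inj₁ t)
      new   : ∀ {x y} → value x ∼[ a ] value y → R a (inj₂ x) (inj₂ y)
      cross : ∀ {x} → Neg.¬ (depth a (value x) ≥ n) → R a (inj₂ x) (inj₁ (value x))

    _∼′[_]_ : State′ → Agent → State′ → Set ℓ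
    x ∼′[ a ] y = TransClosure (SymClosure (R a)) x y

    isEquivalence′ : ∀ a → IsEquivalence (λ x y → x ∼′[ a ] y)
    isEquivalence′ a = record
      { refl  = Trans.reflexive _ (λ {x} → fwd (R-refl x))
      ; sym   = Trans.symmetric _ (Sym.symmetric (R a))
      ; trans = Trans.transitive _
      }
      where
      R-refl : ∀ x → R a x x
      R-refl (inj₁ s) = old (IsEquivalence.refl (isEquivalence a))
      R-refl (inj₂ x) = new (IsEquivalence.refl (isEquivalence a))

    original : State′ → State
    original (inj₁ s) = s
    original (inj₂ x) = value x

    depth′ : Agent → State′ → ℕ
    depth′ a (inj₁ s) = depth a s
    depth′ a (inj₂ x) =
      if does (depth a (value x) <? n)
      then depth a (value x)
      else depth a (value x) ∸ n

    model : Model Agent Atom ℓ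
    model = record
      { State         = State′
      ; _∼[_]_        = _∼′[_]_
      ; isEquivalence = isEquivalence′
      ; V             = λ x → V (original x)
      ; depth         = depth′
      }

  open Model

  -- In the clause for announcements, the model M ∣ φ is Update.model M (Sat M φ)
  -- (modalDepth φ).  The hypothesis that φ holds at s is marked irrelevant
  -- because it is used only to form the state (1 , s).
  Sat : (M : Model Agent Atom ℓ) → Formula Agent Atom → Pred (State M) ℓ
  Sat     M (atom p)  s = V M s p
  Sat {ℓ} M (E a n)   s = Lift ℓ (depth M a s ≡ n)
  Sat {ℓ} M (P a n)   s = Lift ℓ (depth M a s ≥ n)
  Sat     M (¬ φ)     s = Neg.¬ Sat M φ s
  Sat     M (φ ∧ ψ)   s = Sat M φ s × Sat M ψ s
  Sat     M (K a φ)   s = depth M a s ≥ modalDepth φ × (∀ t → _∼[_]_ M s a t → Sat M φ t)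
  Sat     M (K∞ a φ)  s = ∀ t → _∼[_]_ M s a t → Sat M φ t
  Sat     M ([ φ ] ψ) s =
    .(h : Sat M φ s) →
    Sat (Update.model M (Sat M φ) (modalDepth φ)) ψ (inj₂ (s , Irrelevant.[ h ]))

  Unambiguous : Model Agent Atom ℓ → Set (α ⊔ ℓ)
  Unambiguous M = ∀ a s t → _∼[_]_ M s a t → depth M a s ≡ depth M a t

  ValidUnambiguous : (ℓ : Level) → Formula Agent Atom → Set (α ⊔ π ⊔ suc ℓ)
  ValidUnambiguous ℓ φ =
    (M : Model Agent Atom ℓ) → Unambiguous M → (s : State M) → Sat M φ s

{-# OPTIONS --safe #-}

-- Both equivalences compare the state (1 , s) of M ∣ φ with s itself.  By
-- unambiguity the depth of a is constant on ∼ₐ-classes.  If it is below d(φ),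
-- the projection (i , s) ↦ s is a bisimulation for the agent a, and
-- bisimulations for a are preserved by updates with formulas of the
-- a-fragment, which gives (KP).  If it is at least d(φ), no cross edge leaves
-- the ∼′ₐ-class of (1 , s), so this class consists of the (1 , t) with s ∼ₐ t,
-- which gives (TA).
module Submission where

open import Defs
open import Level using (Level; _⊔_; lift)
open import Data.Bool.Base using (if_then_else_)
open import Data.Empty using (⊥-elim-irr)
open import Data.Irrelevant as Irrelevant using ()
open import Data.Nat.Base using (ℕ; _≥_; _<_; _∸_)
open import Data.Nat.Properties
  using (_<?_; ≰⇒>; <⇒≱; ≤⇒≯; +-comm; m+n≤o⇒m≤o∸n; m≤o∸n⇒m+n≤o)
open import Data.Product.Base using (_×_; _,_; ∃)
open import Data.Refinement.Base using (value; proof; _,_)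
open import Data.Sum.Base using (inj₁; inj₂)
open import Data.Sum.Relation.Binary.Pointwise using (Pointwise; inj₁; inj₂)
open import Function.Base using (flip)
open import Relation.Binary.Core using (REL)
open import Relation.Binary.Structures using (IsEquivalence)
open import Relation.Binary.Construct.Closure.Symmetric using (SymClosure; fwd; bwd)
open import Relation.Binary.Construct.Closure.Transitive as Trans using (TransClosure; _∷_)
open import Relation.Binary.PropositionalEquality.Core
  using (_≡_; refl; sym; trans; cong; subst)
open import Relation.Nullary.Decidable using (dec-true; dec-false)
open import Relation.Nullary.Decidable.Core using (does)
open import Relation.Nullary.Negation.Core as Neg using (contradiction)
open import Relation.Unary using (Pred)

open Model

private
  variable
    α π ℓ ℓ′ ζ ζ′ : Level
    Agent : Set α
    Atom : Set π

-- The expression by which `depth′` treats new states, as a function of the old depth `k` alone, so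
-- that equal old depths give equal new ones by `cong`.
updatedDepth : ℕ → ℕ → ℕ
updatedDepth n k = if does (k <? n) then k else k ∸ n

updatedDepth-< : ∀ {n k} → k < n → updatedDepth n k ≡ k
updatedDepth-< {n} {k} k<n =
  cong (λ b → if b then k else k ∸ n) (dec-true (k <? n) k<n)

updatedDepth-≥ : ∀ {n k} → k ≥ n → updatedDepth n k ≡ k ∸ n
updatedDepth-≥ {n} {k} k≥n =
  cong (λ b → if b then k else k ∸ n) (dec-false (k <? n) (≤⇒≯ k≥n))

-- One half of a bisimulation for the single agent `a`. A bisimulation is given as a simulation
-- along `Z` together with one along `flip Z`.
record Simulation {Agent : Set α} {Atom : Set π} (a : Agent)
                  (M : Model Agent Atom ℓ) (N : Model Agent Atom ℓ′)
                  (Z : REL (State M) (State N) ζ) : Set (π ⊔ ℓ ⊔ ℓ′ ⊔ ζ) where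
  field
    atoms  : ∀ {s t} → Z s t → ∀ p → V M s p → V N t p
    depths : ∀ {s t} → Z s t → depth M a s ≡ depth N a t
    forth  : ∀ {s s′ t} → Z s t → _∼[_]_ M s a s′ →
             ∃ λ t′ → _∼[_]_ N t a t′ × Z s′ t′

open Simulation

-- Serves to exchange `flip (LiftRel Z)` and `LiftRel (flip Z)`, which have the same elements but
-- are not definitionally equal.
Simulation-resp : {a : Agent} {M : Model Agent Atom ℓ} {N : Model Agent Atom ℓ′}
                  {Z : REL (State M) (State N) ζ} {W : REL (State M) (State N) ζ′} →
                  (∀ {s t} → Z s t → W s t) → (∀ {s t} → W s t → Z s t) →
                  Simulation a M N Z → Simulation a M N W
Simulation-resp Z⊆W W⊆Z Z-sim = record
  { atoms  = λ w → atoms Z-sim (W⊆Z w)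
  ; depths = λ w → depths Z-sim (W⊆Z w)
  ; forth  = λ w s∼s′ →
      let t′ , t∼t′ , z′ = forth Z-sim (W⊆Z w) s∼s′ in t′ , t∼t′ , Z⊆W z′
  }

module _ (M : Model Agent Atom ℓ) (N : Model Agent Atom ℓ′)
         (X : Pred (State M) ℓ) (Y : Pred (State N) ℓ′) (n : ℕ) where

  private
    module M′ = Update M X n
    module N′ = Update N Y n

  LiftRel : REL (State M) (State N) ζ → REL M′.State′ N′.State′ _
  LiftRel Z = Pointwise Z (λ x y → Z (value x) (value y))

  -- A path is matched edge by edge. `X⇒Y` makes the matching new states exist, and agreement of
  -- depths transfers the condition on cross edges.
  update-simulation : {a : Agent} {Z : REL (State M) (State N) ζ} →
                      (∀ {s t} → Z s t → X s → Y t) →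
                      Simulation a M N Z →
                      Simulation a M′.model N′.model (LiftRel Z)
  update-simulation {a = a} {Z} X⇒Y Z-sim = record
    { atoms  = λ { (inj₁ z) → atoms Z-sim z ; (inj₂ z) → atoms Z-sim z }
    ; depths = λ { (inj₁ z) → depths Z-sim z
                 ; (inj₂ z) → cong (updatedDepth n) (depths Z-sim z) }
    ; forth  = path
    }
    where
    ∼-sym : ∀ {s t} → _∼[_]_ M s a t → _∼[_]_ M t a s
    ∼-sym = IsEquivalence.sym (isEquivalence M a)

    step : ∀ {x x′ y} → LiftRel Z x y → SymClosure (M′.R a) x x′ →
           ∃ λ y′ → SymClosure (N′.R a) y y′ × LiftRel Z x′ y′
    step (inj₁ z) (fwd (Update.old s∼s′)) =
      let t′ , t∼t′ , z′ = forth Z-sim z s∼s′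
      in inj₁ t′ , fwd (Update.old t∼t′) , inj₁ z′
    step (inj₁ z) (bwd (Update.old s′∼s)) =
      let t′ , t∼t′ , z′ = forth Z-sim z (∼-sym s′∼s)
      in inj₁ t′ , fwd (Update.old t∼t′) , inj₁ z′
    step (inj₂ z) (fwd (Update.new {y = x′} s∼s′)) =
      let t′ , t∼t′ , z′ = forth Z-sim z s∼s′
      in inj₂ (t′ , Irrelevant.map (X⇒Y z′) (proof x′)) , fwd (Update.new t∼t′) , inj₂ z′
    step (inj₂ z) (bwd (Update.new {x = x′} s′∼s)) =
      let t′ , t∼t′ , z′ = forth Z-sim z (∼-sym s′∼s)
      in inj₂ (t′ , Irrelevant.map (X⇒Y z′) (proof x′)) , fwd (Update.new t∼t′) , inj₂ z′
    step {y = inj₂ y} (inj₂ z) (fwd (Update.cross d≱n)) =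
      inj₁ (value y) ,
      fwd (Update.cross (subst (λ d → Neg.¬ (d ≥ n)) (depths Z-sim z) d≱n)) ,
      inj₁ z
    -- A reversed cross edge enters the announced extension, so the matching state exists because
    -- `X⇒Y` puts `t` into `Y`.
    step {y = inj₁ t} (inj₁ z) (bwd (Update.cross {x = x′} d≱n)) =
      inj₂ (t , Irrelevant.map (X⇒Y z) (proof x′)) ,
      bwd (Update.cross (subst (λ d → Neg.¬ (d ≥ n)) (depths Z-sim z) d≱n)) ,
      inj₂ z

    path : ∀ {x x′ y} → LiftRel Z x y → TransClosure (SymClosure (M′.R a)) x x′ →
           ∃ λ y′ → TransClosure (SymClosure (N′.R a)) y y′ × LiftRel Z x′ y′
    path z Trans.[ r ] = let y′ , r′ , z′ = step z r in y′ , Trans.[ r′ ] , z′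
    path z (r ∷ rs) =
      let _  , r′  , z′ = step z r
          y′ , rs′ , z″ = path z′ rs
      in y′ , r′ ∷ rs′ , z″

LiftRel-flip : (M : Model Agent Atom ℓ) (N : Model Agent Atom ℓ′)
               (X : Pred (State M) ℓ) (Y : Pred (State N) ℓ′) (n : ℕ)
               {Z : REL (State M) (State N) ζ} → ∀ {x y} →
               LiftRel M N X Y n Z x y → LiftRel N M Y X n (flip Z) y x
LiftRel-flip M N X Y n (inj₁ z) = inj₁ z
LiftRel-flip M N X Y n (inj₂ z) = inj₂ z

-- Induction on `Only a ψ` for all models at once, since an announcement replaces both by their
-- updates. Negation swaps the two simulations, `b` answers the knowledge operators, and invariance
-- of the announced formula in both directions relates the updates.
bisimulation-invariance :
  {a : Agent} {ψ : Formula Agent Atom} → Only a ψ →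
  (M : Model Agent Atom ℓ) (N : Model Agent Atom ℓ′) {Z : REL (State M) (State N) ζ} →
  Simulation a M N Z → Simulation a N M (flip Z) →
  ∀ {s t} → Z s t → Sat M ψ s → Sat N ψ t
bisimulation-invariance (atom p) M N f b z = atoms f z p
bisimulation-invariance (E n) M N f b z (lift d≡n) = lift (trans (sym (depths f z)) d≡n)
bisimulation-invariance (P n) M N f b z (lift d≥n) = lift (subst (_≥ n) (depths f z) d≥n)
bisimulation-invariance (¬ o) M N f b z ¬ψ ψ =
  ¬ψ (bisimulation-invariance o N M b f z ψ)
bisimulation-invariance (o ∧ o′) M N f b z (ψ , ψ′) =
  bisimulation-invariance o M N f b z ψ , bisimulation-invariance o′ M N f b z ψ′
bisimulation-invariance (K {χ} o) M N f b z (d≥ , ψ) =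
  subst (_≥ modalDepth χ) (depths f z) d≥ , λ t′ t∼t′ →
    let s′ , s∼s′ , z′ = forth b z t∼t′
    in bisimulation-invariance o M N f b z′ (ψ s′ s∼s′)
bisimulation-invariance (K∞ o) M N f b z ψ t′ t∼t′ =
  let s′ , s∼s′ , z′ = forth b z t∼t′
  in bisimulation-invariance o M N f b z′ (ψ s′ s∼s′)
bisimulation-invariance ([_]_ {χ} o o′) M N f b z ψ h =
  bisimulation-invariance o′ (Update.model M X n) (Update.model N Y n)
    (update-simulation M N X Y n (bisimulation-invariance o M N f b) f)
    (Simulation-resp (LiftRel-flip N M Y X n) (LiftRel-flip M N X Y n)
      (update-simulation N M Y X n (bisimulation-invariance o N M b f) b))
    (inj₂ z)
    (ψ (bisimulation-invariance o N M b f z h))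
  where
  X = Sat M χ
  Y = Sat N χ
  n = modalDepth χ

module _ (M : Model Agent Atom ℓ) (X : Pred (State M) ℓ) (n : ℕ) where
  open Update M X n

  -- A cross edge joins two copies of one state, so it projects to reflexivity; the closure is
  -- absorbed because `∼` is an equivalence.
  ∼′⇒∼ : ∀ {a x y} → x ∼′[ a ] y → _∼[_]_ M (original x) a (original y)
  ∼′⇒∼ {a} = path
    where
    module ∼ = IsEquivalence (isEquivalence M a)

    edge : ∀ {x y} → R a x y → _∼[_]_ M (original x) a (original y)
    edge (old s∼t)  = s∼t
    edge (new s∼t)  = s∼t
    edge (cross _)  = ∼.refl

    step : ∀ {x y} → SymClosure (R a) x y → _∼[_]_ M (original x) a (original y)
    step (fwd r) = edge r
    step (bwd r) = ∼.sym (edge r)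

    path : ∀ {x y} → x ∼′[ a ] y → _∼[_]_ M (original x) a (original y)
    path Trans.[ r ] = step r
    path (r ∷ rs)    = ∼.trans (step r) (path rs)

  module _ (unambiguous : Unambiguous M) where

    -- The graph of the projection, cut down to states whose depth for the agent is below `n`.
    -- Unambiguity preserves this bound along edges.
    Below : Agent → REL State′ (State M) _
    Below a x s = original x ≡ s × depth M a s < n

    below-simulation : ∀ a → Simulation a model M (Below a)
    below-simulation a = record
      { atoms  = λ { (refl , _) p v → v }
      ; depths = λ { {inj₁ s} (refl , _) → refl
                   ; {inj₂ x} (refl , d<n) → updatedDepth-< d<n }
      ; forth  = λ { {s′ = y} (refl , d<n) x∼′y →
                   original y , ∼′⇒∼ x∼′y ,
                   refl , subst (_< n) (unambiguous a _ _ (∼′⇒∼ x∼′y)) d<n }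
      }

    -- The answer is always the old copy of `t`, as `t` may fail `X`. A new state first crosses to
    -- its own old copy, which the bound `d<n` allows.
    below-simulation-flip : ∀ a → Simulation a M model (flip (Below a))
    below-simulation-flip a = record
      { atoms  = λ { (refl , _) p v → v }
      ; depths = λ {_} {x} z → sym (depths (below-simulation a) {x} z)
      ; forth  = λ { {s′ = t} {x} (refl , d<n) s∼t →
                   inj₁ t , toOld x d<n s∼t ,
                   refl , subst (_< n) (unambiguous a _ _ s∼t) d<n }
      }
      where
      toOld : ∀ x {t} → depth M a (original x) < n →
              _∼[_]_ M (original x) a t → x ∼′[ a ] inj₁ t
      toOld (inj₁ s) _   s∼t = Trans.[ fwd (old s∼t) ]
      toOld (inj₂ x) d<n s∼t = fwd (cross (<⇒≱ d<n)) ∷ Trans.[ fwd (old s∼t) ]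

    -- Only a cross edge leaves the new layer, and it requires depth below `n`; unambiguity carries
    -- the bound `d≥n` to every next state of the path.
    ∼′-stays-new : ∀ {a x y} → depth M a (value x) ≥ n → inj₂ x ∼′[ a ] y →
                   ∃ λ x′ → y ≡ inj₂ x′
    ∼′-stays-new {a} = path
      where
      step : ∀ {x y} → depth M a (value x) ≥ n → SymClosure (R a) (inj₂ x) y →
             ∃ λ x′ → y ≡ inj₂ x′
      step d≥n (fwd (new _))     = _ , refl
      step d≥n (fwd (cross d≱n)) = contradiction d≥n d≱n
      step d≥n (bwd (new _))     = _ , refl

      path : ∀ {x y} → depth M a (value x) ≥ n → inj₂ x ∼′[ a ] y →
             ∃ λ x′ → y ≡ inj₂ x′
      path d≥n Trans.[ r ] = step d≥n r
      path d≥n (r ∷ rs) with step d≥n r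
      ... | x′ , refl =
        path (subst (_≥ n) (unambiguous a _ _ (∼′⇒∼ Trans.[ r ])) d≥n) rs

-- Object-level implications are double-negated, so no excluded middle is
-- needed: from ¬ [ φ ] κ one may refute φ, and then [ φ ] κ holds vacuously.
announcement-⇔ :
  (M : Model Agent Atom ℓ) (χ φ κ κ′ : Formula Agent Atom) (s : State M) →
  let M′ = Update.model M (Sat M φ) (modalDepth φ) in
  (Sat M χ s → (h : Sat M φ s) → Sat M′ κ (inj₂ (s , Irrelevant.[ h ])) → Sat M κ′ s) →
  (Sat M χ s → (h : Sat M φ s) → Sat M κ′ s → Sat M′ κ (inj₂ (s , Irrelevant.[ h ]))) →
  Sat M (χ ⇒ ([ φ ] κ ⇔ (φ ⇒ κ′))) s
announcement-⇔ M χ φ κ κ′ s to from (c , ¬iff) = ¬iff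
  ( (λ (k , ¬k′) → ¬k′ (λ (h , ¬κ′) → ¬κ′ (to c h (k h))))
  , (λ (k′ , ¬k) → ¬k (λ h →
      -- Here `h` is irrelevant, so it may only serve to derive a contradiction.
      ⊥-elim-irr (k′ (h , λ κ′s → ¬k (λ _ → from c h κ′s)))))
  )

theorem3p1 : {α π : Level} (ℓ : Level) {Agent : Set α} {Atom : Set π}
    (φ : Formula Agent Atom) (a : Agent) →
    ((ψ : Formula Agent Atom) → Only a ψ →
    ValidUnambiguous ℓ
    ((¬ P a (modalDepth φ)) ⇒ (([ φ ] (K a ψ)) ⇔ (φ ⇒ K a ψ))))
    ×
    ((ψ : Formula Agent Atom) →
    ValidUnambiguous ℓ
    (P a (modalDepth φ) ⇒ (([ φ ] (K a ψ)) ⇔ (φ ⇒ K a ([ φ ] ψ)))))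
theorem3p1 ℓ {Agent} {Atom} φ a = knowledge-preservation , traditional-announcements
  where
  n = modalDepth φ

  knowledge-preservation : ∀ ψ → Only a ψ →
    ValidUnambiguous ℓ ((¬ P a n) ⇒ ([ φ ] K a ψ ⇔ (φ ⇒ K a ψ)))
  knowledge-preservation ψ o M u s = announcement-⇔ M (¬ P a n) φ (K a ψ) (K a ψ) s
    (λ ¬P h → bisimulation-invariance (K o) M′ M
      (below-simulation M (Sat M φ) n u a) (below-simulation-flip M (Sat M φ) n u a)
      (refl , below ¬P))
    (λ ¬P h → bisimulation-invariance (K o) M M′
      (below-simulation-flip M (Sat M φ) n u a) (below-simulation M (Sat M φ) n u a)
      (refl , below ¬P))
    where
    M′ = Update.model M (Sat M φ) n

    below : Sat M (¬ P a n) s → depth M a s < n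
    below ¬P = ≰⇒> (λ d≥n → ¬P (lift d≥n))

  traditional-announcements : ∀ ψ →
    ValidUnambiguous ℓ (P a n ⇒ ([ φ ] K a ψ ⇔ (φ ⇒ K a ([ φ ] ψ))))
  traditional-announcements ψ M u s =
    announcement-⇔ M (P a n) φ (K a ψ) (K a ([ φ ] ψ)) s to from
    where
    open Update M (Sat M φ) n

    to : Sat M (P a n) s → (h : Sat M φ s) →
         Sat model (K a ψ) (inj₂ (s , Irrelevant.[ h ])) → Sat M (K a ([ φ ] ψ)) s
    to (lift d≥n) h (d′≥ , k) =
      -- The formula `[ φ ] ψ` has modal depth `n` plus that of `ψ`, which matches the `n`
      -- subtracted by the update; `d≥n` rules out truncation.
      subst (depth M a s ≥_) (+-comm (modalDepth ψ) n)
        (m≤o∸n⇒m+n≤o _ d≥n (subst (_≥ modalDepth ψ) (updatedDepth-≥ d≥n) d′≥)) ,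
      λ t s∼t h′ → k (inj₂ (t , Irrelevant.[ h′ ])) Trans.[ fwd (new s∼t) ]

    from : Sat M (P a n) s → (h : Sat M φ s) →
           Sat M (K a ([ φ ] ψ)) s → Sat model (K a ψ) (inj₂ (s , Irrelevant.[ h ]))
    from (lift d≥n) h (d≥ , k) =
      subst (_≥ modalDepth ψ) (sym (updatedDepth-≥ d≥n))
        (m+n≤o⇒m≤o∸n _ (subst (depth M a s ≥_) (+-comm n (modalDepth ψ)) d≥)) ,
      known
      where
      known : ∀ y → inj₂ (s , Irrelevant.[ h ]) ∼′[ a ] y → Sat model ψ y
      -- Every accessible `y` is a new state over some `t` satisfying `φ`, where `[ φ ] ψ` is known
      -- and gives `ψ` at `y`.
      known y x∼′y with ∼′-stays-new M (Sat M φ) n u d≥n x∼′y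
      ... | (t , Irrelevant.[ h′ ]) , refl = k t (∼′⇒∼ M (Sat M φ) n x∼′y) h′
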